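{- For a set of patterns $\{\rho_1,\rho_2\}$, let $\mathrm{a}_{n,k}^{\mathrm{pk}}(\rho_1,\rho_2)$ (respectively $\mathrm{a}_{n,k}^{\mathrm{vl}}(\rho_1,\rho_2)$) denote the number of permutations of $\{1,\dots,n\}$ that avoid both $\rho_1$ and $\rho_2$ and have exactly $k$ peaks (respectively $k$ valleys). Then for all integers $n\ge1$ and $k\ge0$, $$\mathrm{a}_{n,k}^{\mathrm{pk}}(132,213)=\mathrm{a}_{n,k}^{\mathrm{vl}}(132,213)=\mathrm{a}_{n,k}^{\mathrm{pk}}(213,231)=\mathrm{a}_{n,k}^{\mathrm{vl}}(213,231)=\binom{n}{2k+1}.$$
   Context: $\mathcal{S}_n$ is the set of permutations $\pi=\pi_1\cdots\pi_n$ of $\{1,\dots,n\}$. For $\rho\in\mathcal{S}_m$, $\pi\in\mathcal{S}_n$ contains $\rho$ if there are indices $1\le i_1<\cdots<i_m\le n$ such that $\pi_{i_a}<\pi_{i_b}$ if and only if $\rho_a<\rho_b$; otherwise $\pi$ avoids $\rho$. The number of peaks is $\mathrm{pk}(\pi)=|\{i:\pi_i<\pi_{i+1}\text{ and }\pi_{i+1}>\pi_{i+2}\}|$ and the number of valleys is $\mathrm{vl}(\pi)=|\{i:\pi_i>\pi_{i+1}\text{ and }\pi_{i+1}<\pi_{i+2}\}|$, where $1\le i\le n-2$. Binomial coefficients $\binom{m}{j}$ with $j>m\ge 0$ are $0$. -}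

module Defs where

open import Data.Fin.Base using (Fin; suc; inject₁; punchIn; _<_)
open import Data.Fin.Patterns using (0F; 1F; 2F)
open import Data.Fin.Permutation
  using (Permutation′; permutation; id; insert; remove; insert-remove; _⟨$⟩ʳ_; _≈_)
open import Data.Fin.Properties using (_≟_; _<?_; any?; all?; punchIn-injective)
open import Data.List.Base as List using (List; length; filter; allFin; cartesianProductWith)
open import Data.List.Membership.Propositional.Properties using (∈-allFin)
open import Data.List.Relation.Unary.All using ([])
open import Data.List.Relation.Unary.AllPairs using ([]; _∷_)
open import Data.List.Relation.Unary.Any using (here)
open import Data.List.Relation.Unary.Unique.Propositional.Properties using (allFin⁺)
open import Data.Nat.Base using (ℕ; zero; suc; 2+)
import Data.Nat.Properties as ℕ
open import Data.Product.Base using (∃-syntax; _×_; _,_)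
open import Data.Vec.Base using (Vec; []; _∷_; lookup)
open import Function.Base using (case_of_)
open import Function.Bundles using (_⇔_; mk⇔; module Equivalence)
open import Level using (0ℓ)
open import Relation.Binary.Bundles using (Setoid)
open import Relation.Binary.PropositionalEquality
  using (_≡_; refl; sym; trans; cong; setoid)
open import Relation.Nullary.Decidable
  using (Dec; True; toWitness; map′; ¬?; _×-dec_; _→-dec_)
open import Relation.Nullary.Negation using (¬_)
open import Relation.Unary using (Decidable)
import Data.List.Membership.Setoid as Membership
import Data.List.Membership.Setoid.Properties as Membershipₚ
import Data.List.Relation.Unary.Unique.Setoid as Unique
import Data.List.Relation.Unary.Unique.Setoid.Properties as Uniqueₚ

private
  variable
    l m n : ℕ

-- A permutation π₁⋯πₙ of {1,…,n} is a `Permutation′ n`, shifted to {0,…,n-1}.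

permutationSetoid : ℕ → Setoid 0ℓ 0ℓ
permutationSetoid n = record
  { Carrier       = Permutation′ n
  ; _≈_           = _≈_
  ; isEquivalence = record
    { refl  = λ _ → refl
    ; sym   = λ π≈ρ i → sym (π≈ρ i)
    ; trans = λ π≈ρ ρ≈σ i → trans (π≈ρ i) (ρ≈σ i)
    }
  }

-- Every permutation, up to _≈_, exactly once: choose the first letter, then
-- the relative order of the remaining ones.

permutations : ∀ n → List (Permutation′ n)
permutations zero    = List.[ id ]
permutations (suc n) = cartesianProductWith (insert 0F) (allFin (suc n)) (permutations n)

permutations-complete : ∀ n (π : Permutation′ n) →
  let open Membership (permutationSetoid n) in π ∈ permutations n
permutations-complete zero    π = here λ ()
permutations-complete (suc n) π =
  Membershipₚ.∈-resp-≈ (permutationSetoid (suc n))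
    {x = insert 0F (π ⟨$⟩ʳ 0F) (remove 0F π)} {y = π} (insert-remove 0F π)
    (Membershipₚ.∈-cartesianProductWith⁺
      (setoid (Fin (suc n))) (permutationSetoid n) (permutationSetoid (suc n))
      {f = insert 0F}
      (λ { refl π≈ρ 0F      → refl
         ; {x = j} refl π≈ρ (suc k) → cong (punchIn j) (π≈ρ k) })
      (∈-allFin (π ⟨$⟩ʳ 0F)) (permutations-complete n (remove 0F π)))

permutations-unique : ∀ n →
  let open Unique (permutationSetoid n) in Unique (permutations n)
permutations-unique zero    = [] ∷ []
permutations-unique (suc n) =
  Uniqueₚ.cartesianProductWith⁺
    (setoid (Fin (suc n))) (permutationSetoid n) (permutationSetoid (suc n))
    (insert 0F)
    (λ {w} eq → case eq 0F of λ
      { refl → refl , λ k → punchIn-injective w _ _ (eq (suc k)) })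
    (allFin⁺ (suc n)) (permutations-unique n)

-- `oneLine v w` is the permutation with one-line notation v; w is its inverse.

oneLine : (v w : Vec (Fin m) m) →
          {True (all? λ i → lookup v (lookup w i) ≟ i)} →
          {True (all? λ i → lookup w (lookup v i) ≟ i)} →
          Permutation′ m
oneLine v w {vw} {wv} = permutation (lookup v) (lookup w) (toWitness vw) (toWitness wv)

ρ132 ρ213 ρ231 : Permutation′ 3
ρ132 = oneLine (0F ∷ 2F ∷ 1F ∷ []) (0F ∷ 2F ∷ 1F ∷ [])
ρ213 = oneLine (1F ∷ 0F ∷ 2F ∷ []) (1F ∷ 0F ∷ 2F ∷ [])
ρ231 = oneLine (1F ∷ 2F ∷ 0F ∷ []) (2F ∷ 0F ∷ 1F ∷ [])

Increasing : Vec (Fin n) m → Set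
Increasing is = ∀ a b → a < b → lookup is a < lookup is b

OrderIsomorphicAt : Permutation′ n → Vec (Fin n) m → Permutation′ m → Set
OrderIsomorphicAt π is ρ =
  ∀ a b → (π ⟨$⟩ʳ lookup is a < π ⟨$⟩ʳ lookup is b) ⇔ (ρ ⟨$⟩ʳ a < ρ ⟨$⟩ʳ b)

_Contains_ : Permutation′ n → Permutation′ m → Set
_Contains_ {n} {m} π ρ = ∃[ is ] Increasing {n} {m} is × OrderIsomorphicAt π is ρ

_Avoids_ : Permutation′ n → Permutation′ m → Set
π Avoids ρ = ¬ (π Contains ρ)

anyVec? : ∀ {P : Vec (Fin n) m → Set} → Decidable P → Dec (∃[ is ] P is)
anyVec? {m = zero}  P? = map′ ([] ,_) (λ { ([] , p) → p }) (P? [])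
anyVec? {m = suc m} P? =
  map′ (λ { (i , is , p) → i ∷ is , p }) (λ { (i ∷ is , p) → i , is , p })
       (any? λ i → anyVec? λ is → P? (i ∷ is))

increasing? : (is : Vec (Fin n) m) → Dec (Increasing is)
increasing? is = all? λ a → all? λ b → a <? b →-dec lookup is a <? lookup is b

_⇔-dec_ : ∀ {A B : Set} → Dec A → Dec B → Dec (A ⇔ B)
a? ⇔-dec b? =
  map′ (λ { (f , g) → mk⇔ f g }) (λ e → Equivalence.to e , Equivalence.from e)
       ((a? →-dec b?) ×-dec (b? →-dec a?))

orderIsomorphicAt? : (π : Permutation′ n) (is : Vec (Fin n) m) (ρ : Permutation′ m) →
                     Dec (OrderIsomorphicAt π is ρ)
orderIsomorphicAt? π is ρ = all? λ a → all? λ b →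
  (π ⟨$⟩ʳ lookup is a <? π ⟨$⟩ʳ lookup is b) ⇔-dec (ρ ⟨$⟩ʳ a <? ρ ⟨$⟩ʳ b)

_contains?_ : (π : Permutation′ n) (ρ : Permutation′ m) → Dec (π Contains ρ)
π contains? ρ = anyVec? λ is → increasing? is ×-dec orderIsomorphicAt? π is ρ

_avoids?_ : (π : Permutation′ n) (ρ : Permutation′ m) → Dec (π Avoids ρ)
π avoids? ρ = ¬? (π contains? ρ)

-- The positions i, i+1, i+2 of an index 1 ≤ i ≤ n-2, where n = 2+ m.

pos₀ pos₁ pos₂ : Fin m → Fin (2+ m)
pos₀ i = inject₁ (inject₁ i)
pos₁ i = suc (inject₁ i)
pos₂ i = suc (suc i)

IsPeak IsValley : Permutation′ (2+ m) → Fin m → Set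
IsPeak   π i = (π ⟨$⟩ʳ pos₀ i < π ⟨$⟩ʳ pos₁ i) × (π ⟨$⟩ʳ pos₂ i < π ⟨$⟩ʳ pos₁ i)
IsValley π i = (π ⟨$⟩ʳ pos₁ i < π ⟨$⟩ʳ pos₀ i) × (π ⟨$⟩ʳ pos₁ i < π ⟨$⟩ʳ pos₂ i)

isPeak? : (π : Permutation′ (2+ m)) → Decidable (IsPeak π)
isPeak? π i = (π ⟨$⟩ʳ pos₀ i <? π ⟨$⟩ʳ pos₁ i) ×-dec (π ⟨$⟩ʳ pos₂ i <? π ⟨$⟩ʳ pos₁ i)

isValley? : (π : Permutation′ (2+ m)) → Decidable (IsValley π)
isValley? π i = (π ⟨$⟩ʳ pos₁ i <? π ⟨$⟩ʳ pos₀ i) ×-dec (π ⟨$⟩ʳ pos₁ i <? π ⟨$⟩ʳ pos₂ i)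

pk : Permutation′ n → ℕ
pk {0}    π = 0
pk {1}    π = 0
pk {2+ m} π = length (filter (isPeak? π) (allFin m))

vl : Permutation′ n → ℕ
vl {0}    π = 0
vl {1}    π = 0
vl {2+ m} π = length (filter (isValley? π) (allFin m))

module _ (stat : ∀ {n} → Permutation′ n → ℕ) (k : ℕ) (ρ₁ : Permutation′ l) (ρ₂ : Permutation′ m) where

  Counted : Permutation′ n → Set
  Counted π = π Avoids ρ₁ × π Avoids ρ₂ × stat π ≡ k

  counted? : Decidable (Counted {n})
  counted? π = π avoids? ρ₁ ×-dec π avoids? ρ₂ ×-dec stat π ℕ.≟ k

  count : ℕ → ℕ
  count n = length (filter counted? (permutations n))

aᵖᵏ aᵛˡ : (n k : ℕ) → Permutation′ l → Permutation′ m → ℕ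
aᵖᵏ n k ρ₁ ρ₂ = count pk k ρ₁ ρ₂ n
aᵛˡ n k ρ₁ ρ₂ = count vl k ρ₁ ρ₂ n

{-# OPTIONS --safe #-}

-- In an avoider of {213, 231} every letter is the least or the greatest of the
-- letters from it onwards.  In an avoider of {132, 213} every letter is either
-- the greatest of the letters from it onwards or is followed by its successor
-- among them.  So in both classes, prepending a letter can be done in exactly
-- two ways, one creating an initial ascent and the other an initial descent:
-- taking the up-down word is a bijection from the avoiders of length n + 1 to
-- the binary words of length n.  Peaks and valleys are the changes of letter
-- in one of the two directions, and words are counted by Pascal's rule.

module Submission where

open import Defs
open import Data.Nat.Base using (ℕ; _+_; _*_; _≤_)
open import Data.Nat.Combinatorics using (_C_)
open import Data.Product.Base using (_×_)
open import Relation.Binary.PropositionalEquality using (_≡_)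

open import Data.Bool.Base using (Bool; true; false; not; _∧_; _xor_; if_then_else_)
open import Data.Bool.Properties using (not-involutive)
open import Data.Empty using (⊥-elim)
open import Data.Fin.Base using (Fin; zero; suc; toℕ; fromℕ; fromℕ<; inject₁; punchIn; _<_)
open import Data.Fin.Patterns using (0F; 1F; 2F)
open import Data.Fin.Permutation
  using (Permutation′; insert; inverseˡ; inverseʳ; _⟨$⟩ʳ_; _⟨$⟩ˡ_)
open import Data.Fin.Properties
  using (_≟_; _<?_; <-cmp; suc-injective; toℕ-injective; toℕ-inject₁; toℕ-fromℕ; toℕ-fromℕ<;
         toℕ<n; toℕ≤pred[n]; punchIn-mono-≤; punchIn-cancel-≤)
open import Data.List.Base
  using (List; []; _∷_; [_]; _++_; map; length; filter; tabulate; allFin; cartesianProductWith)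
open import Data.List.Membership.Propositional using (_∈_)
open import Data.List.Membership.Propositional.Properties using (∈-allFin; ∈-filter⁺; ∈-filter⁻)
open import Data.List.Membership.Propositional.Properties.WithK using (unique∧set⇒bag)
open import Data.List.Properties
  using (length-++; length-map; filter-++; map-++; filter-accept; filter-reject; filter-none;
         filter-≐; map-tabulate; cartesianProductWith-zeroʳ)
open import Data.List.Relation.Binary.BagAndSetEquality using (∼bag⇒↭)
open import Data.List.Relation.Binary.Permutation.Propositional
  using (_↭_; ↭-refl; ↭-reflexive; ↭-sym; ↭-trans; prep; module PermutationReasoning)
open import Data.List.Relation.Binary.Permutation.Propositional.Properties
  using (↭-length; filter-↭; map⁺; ++⁺; ++⁺ˡ; shift; shifts)
open import Data.List.Relation.Unary.All using ([]; _∷_; universal)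
open import Data.List.Relation.Unary.All.Properties using () renaming (map⁺ to All-map⁺)
open import Data.List.Relation.Unary.AllPairs using ([]; _∷_)
open import Data.List.Relation.Unary.Any using (here; there)
open import Data.List.Relation.Unary.Unique.Propositional.Properties using (allFin⁺; filter⁺)
open import Data.Nat.Base using (zero; suc; 2+; z≤n; s≤s; z<s; s<s; s<s⁻¹; s≤s⁻¹)
import Data.Nat.Base as ℕ
open import Data.Nat.Combinatorics using (nCk+nC[k+1]≡[n+1]C[k+1]; k>n⇒nCk≡0)
import Data.Nat.Properties as ℕ
open import Data.Product.Base using (_,_; proj₂; ∃-syntax)
open import Data.Sum.Base using (_⊎_; inj₁; inj₂)
open import Data.Vec.Base using (lookup; []; _∷_)
open import Data.Vec.Properties using (lookup-map)
open import Function.Base using (_∘_)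
open import Function.Bundles using (_⇔_; mk⇔; module Equivalence)
open import Function.Definitions using (Injective)
open import Relation.Binary.Definitions using (tri<; tri≈; tri>)
open import Relation.Binary.PropositionalEquality
  using (_≢_; refl; sym; trans; cong; cong₂; subst; subst₂; _≗_; module ≡-Reasoning)
open import Relation.Nullary.Decidable using (Dec; does; yes; no; dec-true; dec-false; does-⇔; _×-dec_)
open import Relation.Nullary.Negation using (¬_; contradiction)
open import Relation.Unary using (Decidable)

private
  variable
    A B : Set
    m n : ℕ

-- Filtered lists and their lengths

filter-map : ∀ {P : B → Set} (P? : Decidable P) (f : A → B) →
             filter P? ∘ map f ≗ map f ∘ filter (P? ∘ f)
filter-map P? f []       = refl
filter-map P? f (x ∷ xs) with ih ← filter-map P? f xs | does (P? (f x))
... | true  = cong (f x ∷_) ih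
... | false = ih

-- The product runs through its first list in the outer loop, while the induction on `permutations`
-- groups the insertions by the shorter permutation; regrouping them costs a rearrangement.
cartesianProductWith-∷ʳ : ∀ {C : Set} (f : A → B → C) xs y ys →
  cartesianProductWith f xs (y ∷ ys) ↭ map (λ x → f x y) xs ++ cartesianProductWith f xs ys
cartesianProductWith-∷ʳ f []       y ys = ↭-refl
cartesianProductWith-∷ʳ f (x ∷ xs) y ys = prep (f x y) (↭-trans
  (++⁺ˡ (map (f x) ys) (cartesianProductWith-∷ʳ f xs y ys))
  (shifts (map (f x) ys) (map (λ x → f x y) xs)))

length-filter-tabulate-suc : ∀ {P : Fin (suc n) → Set} (P? : Decidable P) →
  length (filter P? (tabulate suc)) ≡ length (filter (P? ∘ suc) (allFin n))
length-filter-tabulate-suc {n} P? = begin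
  length (filter P? (tabulate suc))
    ≡⟨ cong (length ∘ filter P?) (map-tabulate (λ i → i) suc) ⟨
  length (filter P? (map suc (allFin n)))
    ≡⟨ cong length (filter-map P? suc (allFin n)) ⟩
  length (map suc (filter (P? ∘ suc) (allFin n)))
    ≡⟨ length-map suc (filter (P? ∘ suc) (allFin n)) ⟩
  length (filter (P? ∘ suc) (allFin n)) ∎
  where open ≡-Reasoning

length-filter-allFin-suc : ∀ {P : Fin (suc n) → Set} (P? : Decidable P) →
  length (filter P? (allFin (suc n))) ≡
  (if does (P? zero) then 1 else 0) + length (filter (P? ∘ suc) (allFin n))
length-filter-allFin-suc {n} P? with does (P? zero)
... | true  = cong suc (length-filter-tabulate-suc P?)
... | false = length-filter-tabulate-suc P?

-- Both lists are free of duplicates and have the same members, hence agree as bags.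
filter-allFin-pair : ∀ {P : Fin n → Set} (P? : Decidable P) {i j} → i ≢ j →
  (∀ k → P k ⇔ (k ≡ i ⊎ k ≡ j)) → filter P? (allFin n) ↭ i ∷ j ∷ []
filter-allFin-pair {n} P? {i} {j} i≢j P⇔ = ∼bag⇒↭ (unique∧set⇒bag
  (filter⁺ P? (allFin⁺ n)) ((i≢j ∷ []) ∷ [] ∷ [])
  (mk⇔ (λ k∈ → to (Equivalence.to (P⇔ _) (proj₂ (∈-filter⁻ P? {xs = allFin n} k∈))))
       (λ k∈ → ∈-filter⁺ P? (∈-allFin _) (Equivalence.from (P⇔ _) (from k∈)))))
  where
  to : ∀ {k} → k ≡ i ⊎ k ≡ j → k ∈ i ∷ j ∷ []
  to (inj₁ eq) = here eq
  to (inj₂ eq) = there (here eq)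

  from : ∀ {k} → k ∈ i ∷ j ∷ [] → k ≡ i ⊎ k ≡ j
  from (here eq)         = inj₁ eq
  from (there (here eq)) = inj₂ eq

-- Binary words and their changes of letter

words : ℕ → List (List Bool)
words zero    = [ [] ]
words (suc n) = map (true ∷_) (words n) ++ map (false ∷_) (words n)

-- The number of occurrences of b immediately followed by not b.

turns : Bool → List Bool → ℕ
turns b (x ∷ y ∷ w) = (if not (b xor x) ∧ (b xor y) then 1 else 0) + turns b (y ∷ w)
turns b _           = 0

fibre : (A → ℕ) → ℕ → List A → ℕ
fibre g k xs = length (filter (λ x → g x ℕ.≟ k) xs)

fibre-cong : ∀ {g h : A → ℕ} → g ≗ h → ∀ k → fibre g k ≗ fibre h k
fibre-cong g≗h k xs = cong length
  (filter-≐ _ _ ((λ {x} → trans (sym (g≗h x))) , (λ {x} → trans (g≗h x))) xs)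

fibre-suc-zero : (g : A → ℕ) → ∀ xs → fibre (suc ∘ g) 0 xs ≡ 0
fibre-suc-zero g []       = refl
fibre-suc-zero g (x ∷ xs) = fibre-suc-zero g xs

fibre-suc-suc : (g : A → ℕ) → ∀ k xs → fibre (suc ∘ g) (suc k) xs ≡ fibre g k xs
fibre-suc-suc g k xs = cong length
  (filter-≐ _ _ (ℕ.suc-injective , cong suc) xs)

-- Shaped after `counted?`: it trades counting avoiders by a statistic for counting their up-down
-- words by `turns`.
length-filter-× : ∀ {P Q : A → Set} (P? : Decidable P) (Q? : Decidable Q)
  {f : A → B} {g : B → ℕ} {h : A → ℕ} → h ≗ g ∘ f → ∀ k xs →
  length (filter (λ x → P? x ×-dec Q? x ×-dec h x ℕ.≟ k) xs) ≡
  fibre g k (map f (filter (λ x → P? x ×-dec Q? x) xs))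
length-filter-× P? Q? h≗gf k []       = refl
length-filter-× P? Q? {f} {g} h≗gf k (x ∷ xs) with ih ← length-filter-× P? Q? {f} {g} h≗gf k xs
                                                | does (P? x) | does (Q? x)
... | false | _     = ih
... | true  | false = ih
... | true  | true  rewrite h≗gf x with does (g (f x) ℕ.≟ k)
...   | true  = cong suc ih
...   | false = ih

-- The split is by `b` and `not b` instead of `true` and `false`, so that one recurrence serves
-- peaks and valleys alike.
fibre-words-suc : ∀ b (g : List Bool → ℕ) k n →
  fibre g k (words (suc n)) ≡ fibre (g ∘ (b ∷_)) k (words n) + fibre (g ∘ (not b ∷_)) k (words n)
fibre-words-suc b g k n = trans split (order b)
  where
  open ≡-Reasoning
  P? : Decidable (λ w → g w ≡ k)
  P? w = g w ℕ.≟ k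

  part : ∀ c → length (filter P? (map (c ∷_) (words n))) ≡ fibre (g ∘ (c ∷_)) k (words n)
  part c = trans (cong length (filter-map P? (c ∷_) (words n)))
                 (length-map (c ∷_) (filter (P? ∘ (c ∷_)) (words n)))

  split : fibre g k (words (suc n)) ≡
          fibre (g ∘ (true ∷_)) k (words n) + fibre (g ∘ (false ∷_)) k (words n)
  split = begin
    length (filter P? (map (true ∷_) (words n) ++ map (false ∷_) (words n)))
      ≡⟨ cong length (filter-++ P? (map (true ∷_) (words n)) _) ⟩
    length (filter P? (map (true ∷_) (words n)) ++ filter P? (map (false ∷_) (words n)))
      ≡⟨ length-++ (filter P? (map (true ∷_) (words n))) ⟩
    length (filter P? (map (true ∷_) (words n))) + length (filter P? (map (false ∷_) (words n)))
      ≡⟨ cong₂ _+_ (part true) (part false) ⟩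
    fibre (g ∘ (true ∷_)) k (words n) + fibre (g ∘ (false ∷_)) k (words n) ∎

  order : ∀ b → fibre (g ∘ (true ∷_)) k (words n) + fibre (g ∘ (false ∷_)) k (words n) ≡
                fibre (g ∘ (b ∷_)) k (words n) + fibre (g ∘ (not b ∷_)) k (words n)
  order true  = refl
  order false = ℕ.+-comm (fibre (g ∘ (true ∷_)) k (words n)) _

turns-same : ∀ b w → turns b (b ∷ b ∷ w) ≡ turns b (b ∷ w)
turns-same true  w = refl
turns-same false w = refl

turns-change : ∀ b w → turns b (b ∷ not b ∷ w) ≡ suc (turns b (not b ∷ w))
turns-change true  w = refl
turns-change false w = refl

-- A leading `not b` cannot open an occurrence of `b` followed by `not b`.
turns-not∷ : ∀ b w → turns b (not b ∷ w) ≡ turns b w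
turns-not∷ b     []      = refl
turns-not∷ true  (_ ∷ w) = refl
turns-not∷ false (_ ∷ w) = refl

mutual

  -- After the leading `b`, another `b` changes nothing, whereas `not b` completes a turn and leaves
  -- an unrestricted word with one turn fewer to find. The even lower index here and the odd one in
  -- `fibre-turns` are neighbours in Pascal's rule, which closes both inductions.
  fibre-turns-b∷ : ∀ b k n → fibre (turns b ∘ (b ∷_)) k (words n) ≡ suc n C (2 * k)
  fibre-turns-b∷ b zero    zero    = refl
  fibre-turns-b∷ b (suc k) zero    = sym (k>n⇒nCk≡0 (ℕ.*-monoʳ-≤ 2 (s≤s (z≤n {k}))))
  fibre-turns-b∷ b zero    (suc n) = begin
    fibre (turns b ∘ (b ∷_)) 0 (words (suc n))
      ≡⟨ fibre-turns-b∷-suc b 0 n ⟩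
    suc n C 0 + fibre (suc ∘ turns b ∘ (not b ∷_)) 0 (words n)
      -- A word that begins with `b` and `not b` already has a turn, so none of these has zero
      -- turns.
      ≡⟨ cong (suc n C 0 +_) (fibre-suc-zero (turns b ∘ (not b ∷_)) (words n)) ⟩
    suc n C 0 + 0
      ≡⟨ ℕ.+-identityʳ (suc n C 0) ⟩
    suc n C 0
      ≡⟨⟩
    2+ n C 0 ∎
    where open ≡-Reasoning
  fibre-turns-b∷ b (suc k) (suc n) = begin
    fibre (turns b ∘ (b ∷_)) (suc k) (words (suc n))
      ≡⟨ fibre-turns-b∷-suc b (suc k) n ⟩
    suc n C (2 * suc k) + fibre (suc ∘ turns b ∘ (not b ∷_)) (suc k) (words n)
      ≡⟨ cong (suc n C (2 * suc k) +_) (fibre-suc-suc (turns b ∘ (not b ∷_)) k (words n)) ⟩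
    suc n C (2 * suc k) + fibre (turns b ∘ (not b ∷_)) k (words n)
      ≡⟨ cong₂ _+_ (cong (suc n C_) (ℕ.*-suc 2 k))
           (trans (fibre-cong (turns-not∷ b) k (words n)) (fibre-turns b k n)) ⟩
    suc n C 2+ (2 * k) + suc n C suc (2 * k)
      ≡⟨ ℕ.+-comm (suc n C 2+ (2 * k)) _ ⟩
    suc n C suc (2 * k) + suc n C 2+ (2 * k)
      ≡⟨ nCk+nC[k+1]≡[n+1]C[k+1] (suc n) (suc (2 * k)) ⟩
    2+ n C 2+ (2 * k)
      ≡⟨ cong (2+ n C_) (ℕ.*-suc 2 k) ⟨
    2+ n C (2 * suc k) ∎
    where open ≡-Reasoning

  fibre-turns-b∷-suc : ∀ b k n → fibre (turns b ∘ (b ∷_)) k (words (suc n)) ≡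
    suc n C (2 * k) + fibre (suc ∘ turns b ∘ (not b ∷_)) k (words n)
  fibre-turns-b∷-suc b k n = begin
    fibre (turns b ∘ (b ∷_)) k (words (suc n))
      ≡⟨ fibre-words-suc b (turns b ∘ (b ∷_)) k n ⟩
    fibre (turns b ∘ (b ∷_) ∘ (b ∷_)) k (words n) + fibre (turns b ∘ (b ∷_) ∘ (not b ∷_)) k (words n)
      ≡⟨ cong₂ _+_ (trans (fibre-cong (turns-same b) k (words n)) (fibre-turns-b∷ b k n))
                   (fibre-cong (turns-change b) k (words n)) ⟩
    suc n C (2 * k) + fibre (suc ∘ turns b ∘ (not b ∷_)) k (words n) ∎
    where open ≡-Reasoning

  fibre-turns : ∀ b k n → fibre (turns b) k (words n) ≡ suc n C suc (2 * k)
  fibre-turns b zero    zero    = refl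
  -- The empty word has no turns. The implicit argument is what remains of `2 * suc k` after one
  -- successor is removed.
  fibre-turns b (suc k) zero    = sym (k>n⇒nCk≡0 (s<s (z<s {k + 1 * suc k})))
  fibre-turns b k       (suc n) = begin
    fibre (turns b) k (words (suc n))
      ≡⟨ fibre-words-suc b (turns b) k n ⟩
    fibre (turns b ∘ (b ∷_)) k (words n) + fibre (turns b ∘ (not b ∷_)) k (words n)
      ≡⟨ cong₂ _+_ (fibre-turns-b∷ b k n)
           (trans (fibre-cong (turns-not∷ b) k (words n)) (fibre-turns b k n)) ⟩
    suc n C (2 * k) + suc n C suc (2 * k)
      ≡⟨ nCk+nC[k+1]≡[n+1]C[k+1] (suc n) (2 * k) ⟩
    2+ n C suc (2 * k) ∎
    where open ≡-Reasoning

-- The up-down word of a permutation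

-- Defined for functions because the recursion drops the first entry, and `f ∘ suc` is no longer a
-- permutation. The letter `true` stands for an ascent.
steps : (Fin (suc n) → Fin m) → List Bool
steps {zero}  f = []
steps {suc n} f = does (f 0F <? f 1F) ∷ steps (f ∘ suc)

upDown : Permutation′ (suc n) → List Bool
upDown π = steps (π ⟨$⟩ʳ_)

⟨$⟩ʳ-injective : (π : Permutation′ n) → Injective _≡_ _≡_ (π ⟨$⟩ʳ_)
⟨$⟩ʳ-injective π eq = trans (sym (inverseˡ π)) (trans (cong (π ⟨$⟩ˡ_) eq) (inverseˡ π))

does-<?-flip : {i j : Fin n} → i ≢ j → does (j <? i) ≡ not (does (i <? j))
does-<?-flip {i = i} {j} i≢j with <-cmp i j
... | tri< i<j _ j≮i = trans (dec-false (j <? i) j≮i) (cong not (sym (dec-true (i <? j) i<j)))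
... | tri≈ _ i≡j _   = contradiction i≡j i≢j
... | tri> i≮j _ j<i = trans (dec-true (j <? i) j<i) (cong not (sym (dec-false (i <? j) i≮j)))

-- Injectivity makes neighbouring entries distinct, so a step that is not an ascent is a descent,
-- and a peak is an ascent followed by a descent.
peaks≡turns : (f : Fin (2+ m) → Fin n) → Injective _≡_ _≡_ f →
  length (filter (λ i → f (pos₀ i) <? f (pos₁ i) ×-dec f (pos₂ i) <? f (pos₁ i)) (allFin m)) ≡
  turns true (steps f)
peaks≡turns {zero}  f inj = refl
peaks≡turns {suc m} f inj = trans
  (length-filter-allFin-suc (λ i → f (pos₀ i) <? f (pos₁ i) ×-dec f (pos₂ i) <? f (pos₁ i)))
  (cong₂ _+_
    (cong (if_then 1 else 0)
      -- At `b = true` the test in `turns` on letters x and y computes to `not (not x) ∧ not y`.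
      (cong₂ _∧_ (sym (not-involutive (does (f 0F <? f 1F)))) (does-<?-flip (λ eq → contradiction (inj eq) λ ()))))
    (peaks≡turns (f ∘ suc) (λ eq → suc-injective (inj eq))))

valleys≡turns : (f : Fin (2+ m) → Fin n) → Injective _≡_ _≡_ f →
  length (filter (λ i → f (pos₁ i) <? f (pos₀ i) ×-dec f (pos₁ i) <? f (pos₂ i)) (allFin m)) ≡
  turns false (steps f)
valleys≡turns {zero}  f inj = refl
valleys≡turns {suc m} f inj = trans
  (length-filter-allFin-suc (λ i → f (pos₁ i) <? f (pos₀ i) ×-dec f (pos₁ i) <? f (pos₂ i)))
  (cong₂ _+_
    (cong (if_then 1 else 0)
      (cong₂ _∧_ (does-<?-flip (λ eq → contradiction (inj eq) λ ())) refl))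
    (valleys≡turns (f ∘ suc) (λ eq → suc-injective (inj eq))))

pk≡turns : (π : Permutation′ (suc n)) → pk π ≡ turns true (upDown π)
pk≡turns {zero}  π = refl
pk≡turns {suc n} π = peaks≡turns (π ⟨$⟩ʳ_) (⟨$⟩ʳ-injective π)

vl≡turns : (π : Permutation′ (suc n)) → vl π ≡ turns false (upDown π)
vl≡turns {zero}  π = refl
vl≡turns {suc n} π = valleys≡turns (π ⟨$⟩ʳ_) (⟨$⟩ʳ-injective π)

-- Prepending a letter

-- `punchIn i` fixes the values below `i` and raises the others by one; the value equal to `i` is
-- raised too, hence the weak inequality.
i<punchIn⁺ : (i : Fin (suc n)) (k : Fin n) → toℕ i ≤ toℕ k → i < punchIn i k
i<punchIn⁺ zero    k       _   = z<s
i<punchIn⁺ (suc i) (suc k) i≤k = s<s (i<punchIn⁺ i k (s≤s⁻¹ i≤k))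

punchIn<i⁺ : (i : Fin (suc n)) (k : Fin n) → toℕ k ℕ.< toℕ i → punchIn i k < i
punchIn<i⁺ (suc i) zero    _   = z<s
punchIn<i⁺ (suc i) (suc k) k<i = s<s (punchIn<i⁺ i k (s<s⁻¹ k<i))

i<punchIn⁻ : (i : Fin (suc n)) (k : Fin n) → i < punchIn i k → toℕ i ≤ toℕ k
i<punchIn⁻ i k lt = ℕ.≮⇒≥ λ k<i → ℕ.<-asym lt (punchIn<i⁺ i k k<i)

punchIn<i⁻ : (i : Fin (suc n)) (k : Fin n) → punchIn i k < i → toℕ k ℕ.< toℕ i
punchIn<i⁻ i k lt = ℕ.≰⇒> λ i≤k → ℕ.<-asym lt (i<punchIn⁺ i k i≤k)

punchIn-mono-< : (i : Fin (suc n)) {j k : Fin n} → j < k → punchIn i j < punchIn i k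
punchIn-mono-< i {j} {k} j<k = ℕ.≰⇒> λ ≤ → ℕ.<⇒≱ j<k (punchIn-cancel-≤ i k j ≤)

punchIn-cancel-< : (i : Fin (suc n)) {j k : Fin n} → punchIn i j < punchIn i k → j < k
punchIn-cancel-< i {j} {k} lt = ℕ.≰⇒> λ ≤ → ℕ.<⇒≱ lt (punchIn-mono-≤ i k j ≤)

-- `punchIn i` preserves and reflects the order, so making room for a new letter leaves the ascents
-- among the old ones unchanged.
steps-punchIn : (i : Fin (suc m)) (f : Fin (suc n) → Fin m) → steps (punchIn i ∘ f) ≡ steps f
steps-punchIn {n = zero}  i f = refl
steps-punchIn {n = suc n} i f = cong₂ _∷_
  (does-⇔ (mk⇔ (punchIn-cancel-< i) (punchIn-mono-< i)) (_ <? _) (_ <? _))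
  (steps-punchIn i (f ∘ suc))

upDown-insert : (j : Fin (2+ n)) (π : Permutation′ (suc n)) →
  upDown (insert 0F j π) ≡ does (j <? punchIn j (π ⟨$⟩ʳ 0F)) ∷ upDown π
upDown-insert j π = cong (does (j <? punchIn j (π ⟨$⟩ʳ 0F)) ∷_) (steps-punchIn j (π ⟨$⟩ʳ_))

-- The entries of f at positions i, j, k are in the order prescribed by ρ.

Matches : Permutation′ 3 → (Fin n → Fin m) → (i j k : Fin n) → Set
Matches ρ f i j k = entry 0F < entry 1F × entry 1F < entry 2F
  where entry = λ c → f (lookup (i ∷ j ∷ k ∷ []) (ρ ⟨$⟩ˡ c))

-- `ρ ⟨$⟩ˡ c` is the position of the value `c` in `ρ`; reading an occurrence by increasing value
-- turns the order isomorphism into a chain of two inequalities.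
contains⇒matches : {π : Permutation′ n} {ρ : Permutation′ 3} → π Contains ρ →
  ∃[ i ] ∃[ j ] ∃[ k ] i < j × j < k × Matches ρ (π ⟨$⟩ʳ_) i j k
contains⇒matches {π = π} {ρ} (i ∷ j ∷ k ∷ [] , inc , iso) =
  i , j , k , inc 0F 1F z<s , inc 1F 2F (s<s z<s) , ordered z<s , ordered (s<s z<s)
  where
  ordered : ∀ {c d} → c < d →
            π ⟨$⟩ʳ lookup (i ∷ j ∷ k ∷ []) (ρ ⟨$⟩ˡ c) < π ⟨$⟩ʳ lookup (i ∷ j ∷ k ∷ []) (ρ ⟨$⟩ˡ d)
  ordered c<d = Equivalence.from (iso _ _) (subst₂ _<_ (sym (inverseʳ ρ)) (sym (inverseʳ ρ)) c<d)

increasing₃ : (f : Fin 3 → Fin n) → f 0F < f 1F → f 1F < f 2F → ∀ c d → c < d → f c < f d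
increasing₃ f p q 0F 1F _ = p
increasing₃ f p q 0F 2F _ = ℕ.<-trans p q
increasing₃ f p q 1F 2F _ = q
increasing₃ f p q 1F 1F (s≤s ())
increasing₃ f p q 2F 1F (s≤s ())
increasing₃ f p q 2F 2F (s≤s (s≤s ()))

-- Preserving the order is enough: by trichotomy and the injectivity of `ρ`, a map that preserves a
-- strict total order also reflects it.
matches⇒contains : {π : Permutation′ n} {ρ : Permutation′ 3} {i j k : Fin n} →
  i < j → j < k → Matches ρ (π ⟨$⟩ʳ_) i j k → π Contains ρ
matches⇒contains {π = π} {ρ} {i} {j} {k} i<j j<k (p , q) =
  is , increasing₃ (lookup is) i<j j<k , λ a b → mk⇔ (reflects a b) (preserves a b)
  where
  is = i ∷ j ∷ k ∷ []

  preserves : ∀ a b → ρ ⟨$⟩ʳ a < ρ ⟨$⟩ʳ b → π ⟨$⟩ʳ lookup is a < π ⟨$⟩ʳ lookup is b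
  preserves a b lt = subst₂ (λ a b → π ⟨$⟩ʳ lookup is a < π ⟨$⟩ʳ lookup is b)
    (inverseˡ ρ) (inverseˡ ρ)
    (increasing₃ (λ c → π ⟨$⟩ʳ lookup is (ρ ⟨$⟩ˡ c)) p q _ _ lt)

  reflects : ∀ a b → π ⟨$⟩ʳ lookup is a < π ⟨$⟩ʳ lookup is b → ρ ⟨$⟩ʳ a < ρ ⟨$⟩ʳ b
  reflects a b lt with <-cmp (ρ ⟨$⟩ʳ a) (ρ ⟨$⟩ʳ b)
  ... | tri< ρa<ρb _ _ = ρa<ρb
  ... | tri≈ _ ρa≡ρb _ with refl ← ⟨$⟩ʳ-injective ρ ρa≡ρb = contradiction lt (ℕ.<-irrefl refl)
  ... | tri> _ _ ρb<ρa = contradiction (preserves b a ρb<ρa) (ℕ.<-asym lt)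

module _ {ρ : Permutation′ 3} (j : Fin (suc n)) (π : Permutation′ n) where

  private
    lookup-suc : ∀ (a b c : Fin n) d →
                 lookup (suc a ∷ suc b ∷ suc c ∷ []) d ≡ suc (lookup (a ∷ b ∷ c ∷ []) d)
    lookup-suc a b c d = lookup-map d suc (a ∷ b ∷ c ∷ [])

    σ = insert 0F j π

  avoids-tail : σ Avoids ρ → π Avoids ρ
  avoids-tail σ-avoids π-contains
    with a , b , c , a<b , b<c , p , q ← contains⇒matches {π = π} {ρ} π-contains =
    σ-avoids (matches⇒contains {π = σ} {ρ} (s<s a<b) (s<s b<c)
      (lift (ρ ⟨$⟩ˡ 0F) (ρ ⟨$⟩ˡ 1F) p , lift (ρ ⟨$⟩ˡ 1F) (ρ ⟨$⟩ˡ 2F) q))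
    where
    lift : ∀ d e → π ⟨$⟩ʳ lookup (a ∷ b ∷ c ∷ []) d < π ⟨$⟩ʳ lookup (a ∷ b ∷ c ∷ []) e →
           σ ⟨$⟩ʳ lookup (suc a ∷ suc b ∷ suc c ∷ []) d < σ ⟨$⟩ʳ lookup (suc a ∷ suc b ∷ suc c ∷ []) e
    lift d e lt = subst₂ (λ x y → σ ⟨$⟩ʳ x < σ ⟨$⟩ʳ y)
      (sym (lookup-suc a b c d)) (sym (lookup-suc a b c e)) (punchIn-mono-< j lt)

  -- The new letter can only be the first entry of an occurrence. An occurrence without it lies in
  -- the tail, which is ordered as in `π`.
  avoids-insert : π Avoids ρ → (∀ a b → a < b → ¬ Matches ρ (σ ⟨$⟩ʳ_) 0F (suc a) (suc b)) → σ Avoids ρ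
  avoids-insert π-avoids ¬head σ-contains with contains⇒matches {π = σ} {ρ} σ-contains
  ... | zero , suc b , suc c , _ , b<c , match = ¬head b c (s<s⁻¹ b<c) match
  ... | suc a , suc b , suc c , a<b , b<c , p , q =
    π-avoids (matches⇒contains {π = π} {ρ} (s<s⁻¹ a<b) (s<s⁻¹ b<c)
      (lower (ρ ⟨$⟩ˡ 0F) (ρ ⟨$⟩ˡ 1F) p , lower (ρ ⟨$⟩ˡ 1F) (ρ ⟨$⟩ˡ 2F) q))
    where
    lower : ∀ d e →
            σ ⟨$⟩ʳ lookup (suc a ∷ suc b ∷ suc c ∷ []) d < σ ⟨$⟩ʳ lookup (suc a ∷ suc b ∷ suc c ∷ []) e →
            π ⟨$⟩ʳ lookup (a ∷ b ∷ c ∷ []) d < π ⟨$⟩ʳ lookup (a ∷ b ∷ c ∷ []) e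
    lower d e lt = punchIn-cancel-< j (subst₂ (λ x y → σ ⟨$⟩ʳ x < σ ⟨$⟩ʳ y)
      (lookup-suc a b c d) (lookup-suc a b c e) lt)

avoids-singleton : (π : Permutation′ 1) (ρ : Permutation′ 3) → π Avoids ρ
avoids-singleton π ρ π-contains with contains⇒matches {π = π} {ρ} π-contains
... | zero , zero , _ , () , _

-- Classes in which a letter can be prepended in two ways

module TwoWaysToPrepend
  {Good : ∀ {n} → Permutation′ n → Set}
  (good? : ∀ {n} → Decidable (Good {n}))
  (up down : ∀ {n} → Permutation′ (suc n) → Fin (2+ n))
  -- A new letter equal to the old first letter pushes that one up and so makes an ascent; a descent
  -- needs a strictly larger new letter.
  (up≤head : ∀ {n} (π : Permutation′ (suc n)) → toℕ (up π) ≤ toℕ (π ⟨$⟩ʳ 0F))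
  (head<down : ∀ {n} (π : Permutation′ (suc n)) → toℕ (π ⟨$⟩ʳ 0F) ℕ.< toℕ (down π))
  (good-singleton : (π : Permutation′ 1) → Good π)
  (good-tail : ∀ {n} j (π : Permutation′ n) → Good (insert 0F j π) → Good π)
  (insert⁺ : ∀ {n} (π : Permutation′ (suc n)) j → Good π →
             j ≡ up π ⊎ j ≡ down π → Good (insert 0F j π))
  (insert⁻ : ∀ {n} (π : Permutation′ (suc n)) j → Good (insert 0F j π) →
             j ≡ up π ⊎ j ≡ down π)
  where

  upDowns : List (Permutation′ (suc n)) → List (List Bool)
  upDowns πs = map upDown (filter good? πs)

  upDowns-++ : (πs σs : List (Permutation′ (suc n))) → upDowns (πs ++ σs) ≡ upDowns πs ++ upDowns σs
  upDowns-++ πs σs = trans (cong (map upDown) (filter-++ good? πs σs))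
                           (map-++ upDown (filter good? πs) (filter good? σs))

  upDown-insert-up : (π : Permutation′ (suc n)) → upDown (insert 0F (up π) π) ≡ true ∷ upDown π
  upDown-insert-up π = trans (upDown-insert (up π) π)
    (cong (_∷ upDown π) (dec-true (_ <? _) (i<punchIn⁺ (up π) _ (up≤head π))))

  upDown-insert-down : (π : Permutation′ (suc n)) → upDown (insert 0F (down π) π) ≡ false ∷ upDown π
  upDown-insert-down π = trans (upDown-insert (down π) π)
    (cong (_∷ upDown π) (dec-false (_ <? _)
      (λ lt → ℕ.<⇒≱ (head<down π) (i<punchIn⁻ (down π) _ lt))))

  up≢down : (π : Permutation′ (suc n)) → up π ≢ down π
  up≢down π eq = ℕ.<⇒≱ (head<down π) (subst (λ j → toℕ j ≤ _) eq (up≤head π))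

  goodHeads : (π : Permutation′ (suc n)) → Good π →
    filter (λ j → good? (insert 0F j π)) (allFin (2+ n)) ↭ up π ∷ down π ∷ []
  goodHeads π good = filter-allFin-pair (λ j → good? (insert 0F j π)) (up≢down π)
    (λ j → mk⇔ (insert⁻ π j) (insert⁺ π j good))

  insertions : Permutation′ (suc n) → List (Permutation′ (2+ n))
  insertions π = map (λ j → insert 0F j π) (allFin _)

  upDowns-insertions : (π : Permutation′ (suc n)) → Good π →
    upDowns (insertions π) ↭ (true ∷ upDown π) ∷ (false ∷ upDown π) ∷ []
  upDowns-insertions {n} π good = begin
    upDowns (insertions π)
      ≡⟨ cong (map upDown) (filter-map good? (λ j → insert 0F j π) (allFin _)) ⟩
    map upDown (map (λ j → insert 0F j π) (filter (λ j → good? (insert 0F j π)) (allFin _)))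
      ↭⟨ map⁺ upDown (map⁺ (λ j → insert 0F j π) (goodHeads π good)) ⟩
    upDown (insert 0F (up π) π) ∷ upDown (insert 0F (down π) π) ∷ []
      ≡⟨ cong₂ (λ v w → v ∷ w ∷ []) (upDown-insert-up π) (upDown-insert-down π) ⟩
    (true ∷ upDown π) ∷ (false ∷ upDown π) ∷ [] ∎
    where open PermutationReasoning

  -- By `good-tail`, no extension of a bad permutation is good.
  upDowns-insertions-bad : (π : Permutation′ (suc n)) → ¬ Good π →
    upDowns (insertions π) ≡ []
  upDowns-insertions-bad π bad = cong (map upDown) (filter-none good? (All-map⁺ (universal
    (λ j → bad ∘ good-tail j π) (allFin _))))

  -- Each good permutation contributes its word once behind `true` and once behind `false`; a bad
  -- one contributes nothing.
  upDowns-cartesianProduct : (πs : List (Permutation′ (suc n))) →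
    upDowns (cartesianProductWith (insert 0F) (allFin (2+ n)) πs) ↭
    map (true ∷_) (upDowns πs) ++ map (false ∷_) (upDowns πs)
  upDowns-cartesianProduct {n} [] =
    ↭-reflexive (cong upDowns (cartesianProductWith-zeroʳ (insert 0F) (allFin (2+ n))))
  upDowns-cartesianProduct {n} (π ∷ πs) = begin
    upDowns (cartesianProductWith (insert 0F) (allFin (2+ n)) (π ∷ πs))
      ↭⟨ map⁺ upDown (filter-↭ good? (cartesianProductWith-∷ʳ (insert 0F) (allFin (2+ n)) π πs)) ⟩
    upDowns (insertions π ++ rest)
      ≡⟨ upDowns-++ (insertions π) rest ⟩
    upDowns (insertions π) ++ upDowns rest
      ↭⟨ ++⁺ˡ (upDowns (insertions π)) (upDowns-cartesianProduct πs) ⟩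
    upDowns (insertions π) ++ map (true ∷_) (upDowns πs) ++ map (false ∷_) (upDowns πs)
      ↭⟨ add (good? π) ⟩
    map (true ∷_) (upDowns (π ∷ πs)) ++ map (false ∷_) (upDowns (π ∷ πs)) ∎
    where
    open PermutationReasoning
    rest = cartesianProductWith (insert 0F) (allFin (2+ n)) πs
    ws   = upDowns πs

    add : Dec (Good π) →
          upDowns (insertions π) ++ map (true ∷_) ws ++ map (false ∷_) ws ↭
          map (true ∷_) (upDowns (π ∷ πs)) ++ map (false ∷_) (upDowns (π ∷ πs))
    add (yes good) = begin
      upDowns (insertions π) ++ map (true ∷_) ws ++ map (false ∷_) ws
        ↭⟨ ++⁺ (upDowns-insertions π good) ↭-refl ⟩
      (true ∷ upDown π) ∷ (false ∷ upDown π) ∷ map (true ∷_) ws ++ map (false ∷_) ws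
        -- The word that begins with `false` moves past the whole block of words that begin with
        -- `true`.
        ↭⟨ prep _ (↭-sym (shift (false ∷ upDown π) (map (true ∷_) ws) (map (false ∷_) ws))) ⟩
      map (true ∷_) (upDown π ∷ ws) ++ map (false ∷_) (upDown π ∷ ws)
        ≡⟨ cong (λ σs → map (true ∷_) (map upDown σs) ++ map (false ∷_) (map upDown σs))
             (filter-accept good? good) ⟨
      map (true ∷_) (upDowns (π ∷ πs)) ++ map (false ∷_) (upDowns (π ∷ πs)) ∎
    add (no bad) = begin
      upDowns (insertions π) ++ map (true ∷_) ws ++ map (false ∷_) ws
        ≡⟨ cong (_++ map (true ∷_) ws ++ map (false ∷_) ws) (upDowns-insertions-bad π bad) ⟩
      map (true ∷_) ws ++ map (false ∷_) ws
        ≡⟨ cong (λ σs → map (true ∷_) (map upDown σs) ++ map (false ∷_) (map upDown σs))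
             (filter-reject good? bad) ⟨
      map (true ∷_) (upDowns (π ∷ πs)) ++ map (false ∷_) (upDowns (π ∷ πs)) ∎

  -- This is the bijection in list form: `words n` contains every binary word of length `n` exactly
  -- once.
  upDowns-permutations : ∀ n → upDowns (permutations (suc n)) ↭ words n
  upDowns-permutations zero    = ↭-reflexive (cong (map upDown)
    (filter-accept good? (good-singleton _)))
  upDowns-permutations (suc n) = ↭-trans
    (upDowns-cartesianProduct (permutations (suc n)))
    (++⁺ (map⁺ (true ∷_) (upDowns-permutations n)) (map⁺ (false ∷_) (upDowns-permutations n)))

  fibre-upDowns : ∀ b k n → fibre (turns b) k (upDowns (permutations (suc n))) ≡ suc n C suc (2 * k)
  fibre-upDowns b k n = trans
    (↭-length (filter-↭ (λ w → turns b w ℕ.≟ k) (upDowns-permutations n)))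
    (fibre-turns b k n)

-- Avoiders of two patterns of length three

AvoidsBoth : (ρ₁ ρ₂ : Permutation′ 3) → Permutation′ n → Set
AvoidsBoth ρ₁ ρ₂ π = π Avoids ρ₁ × π Avoids ρ₂

module AvoidersOfTwo
  (ρ₁ ρ₂ : Permutation′ 3)
  (up down : ∀ {n} → Permutation′ (suc n) → Fin (2+ n))
  (up≤head : ∀ {n} (π : Permutation′ (suc n)) → toℕ (up π) ≤ toℕ (π ⟨$⟩ʳ 0F))
  (head<down : ∀ {n} (π : Permutation′ (suc n)) → toℕ (π ⟨$⟩ʳ 0F) ℕ.< toℕ (down π))
  (insert⁺ : ∀ {n} (π : Permutation′ (suc n)) j → AvoidsBoth ρ₁ ρ₂ π →
             j ≡ up π ⊎ j ≡ down π → AvoidsBoth ρ₁ ρ₂ (insert 0F j π))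
  (insert⁻ : ∀ {n} (π : Permutation′ (suc n)) j → AvoidsBoth ρ₁ ρ₂ (insert 0F j π) →
             j ≡ up π ⊎ j ≡ down π)
  where

  module Ways = TwoWaysToPrepend {AvoidsBoth ρ₁ ρ₂}
    (λ π → π avoids? ρ₁ ×-dec π avoids? ρ₂) up down up≤head head<down
    (λ π → avoids-singleton π ρ₁ , avoids-singleton π ρ₂)
    (λ j π (g₁ , g₂) → avoids-tail {ρ = ρ₁} j π g₁ , avoids-tail {ρ = ρ₂} j π g₂)
    insert⁺ insert⁻

  count≡C : (stat : ∀ {n} → Permutation′ n → ℕ) (b : Bool) →
            (∀ {n} (π : Permutation′ (suc n)) → stat π ≡ turns b (upDown π)) →
            ∀ n k → 1 ≤ n → count stat k ρ₁ ρ₂ n ≡ n C (2 * k + 1)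
  count≡C stat b stat≡turns (suc n) k _ = begin
    count stat k ρ₁ ρ₂ (suc n)
      ≡⟨ length-filter-× (_avoids? ρ₁) (_avoids? ρ₂) stat≡turns k (permutations (suc n)) ⟩
    fibre (turns b) k (Ways.upDowns (permutations (suc n)))
      ≡⟨ Ways.fibre-upDowns b k n ⟩
    suc n C suc (2 * k)
      ≡⟨ cong (suc n C_) (ℕ.+-comm 1 (2 * k)) ⟩
    suc n C (2 * k + 1) ∎
    where open ≡-Reasoning

-- The two pairs of patterns

≢fromℕ⇒< : {i : Fin (suc n)} → i ≢ fromℕ n → toℕ i ℕ.< n
≢fromℕ⇒< {n} {i} i≢n =
  ℕ.≤∧≢⇒< (toℕ≤pred[n] i) λ eq → i≢n (toℕ-injective (trans eq (sym (toℕ-fromℕ n))))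

≢0F⇒0< : {i : Fin (suc n)} → i ≢ 0F → zero {n} < i
≢0F⇒0< {i = zero}  i≢0 = contradiction refl i≢0
≢0F⇒0< {i = suc i} _   = z<s

≮punchIn-fromℕ : (k : Fin n) → ¬ fromℕ n < punchIn (fromℕ n) k
≮punchIn-fromℕ {n} k lt =
  ℕ.<⇒≱ (toℕ<n k) (subst (_≤ toℕ k) (toℕ-fromℕ n) (i<punchIn⁻ (fromℕ n) k lt))

head<fromℕ : (π : Permutation′ (suc n)) → toℕ (π ⟨$⟩ʳ 0F) ℕ.< toℕ (fromℕ (suc n))
head<fromℕ {n} π = subst (toℕ (π ⟨$⟩ʳ 0F) ℕ.<_) (sym (toℕ-fromℕ (suc n))) (toℕ<n (π ⟨$⟩ʳ 0F))

module Avoid213,231 where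

  -- Both 213 and 231 begin with their middle value, so neither the least nor the greatest letter
  -- can open an occurrence.
  insert⁺ : (π : Permutation′ (suc n)) (j : Fin (2+ n)) → AvoidsBoth ρ213 ρ231 π →
            j ≡ 0F ⊎ j ≡ fromℕ (suc n) → AvoidsBoth ρ213 ρ231 (insert 0F j π)
  insert⁺ π j (g₁ , g₂) (inj₁ refl) =
    avoids-insert {ρ = ρ213} j π g₁ (λ _ _ _ ()) ,
    avoids-insert {ρ = ρ231} j π g₂ (λ _ _ _ ())
  insert⁺ π j (g₁ , g₂) (inj₂ refl) =
    avoids-insert {ρ = ρ213} j π g₁ (λ _ _ _ (_ , lt) → ≮punchIn-fromℕ _ lt) ,
    avoids-insert {ρ = ρ231} j π g₂ (λ _ _ _ (_ , lt) → ≮punchIn-fromℕ _ lt)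

  -- A smaller and a larger letter after `j` complete a 213 if the smaller comes first and a 231
  -- otherwise.
  not-between : (π : Permutation′ (suc n)) (j : Fin (2+ n)) → AvoidsBoth ρ213 ρ231 (insert 0F j π) →
    ∀ a b → toℕ (π ⟨$⟩ʳ a) ℕ.< toℕ j → ¬ toℕ j ≤ toℕ (π ⟨$⟩ʳ b)
  not-between π j (g₁ , g₂) a b πa<j j≤πb with <-cmp a b
  ... | tri< a<b _ _ = g₁ (matches⇒contains {π = insert 0F j π} {ρ213} z<s (s<s a<b)
                            (punchIn<i⁺ j _ πa<j , i<punchIn⁺ j _ j≤πb))
  ... | tri≈ _ refl _ = ℕ.<⇒≱ πa<j j≤πb
  ... | tri> _ _ b<a = g₂ (matches⇒contains {π = insert 0F j π} {ρ231} z<s (s<s b<a)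
                            (punchIn<i⁺ j _ πa<j , i<punchIn⁺ j _ j≤πb))

  insert⁻ : (π : Permutation′ (suc n)) (j : Fin (2+ n)) → AvoidsBoth ρ213 ρ231 (insert 0F j π) →
            j ≡ 0F ⊎ j ≡ fromℕ (suc n)
  insert⁻ {n} π j good with j ≟ 0F | j ≟ fromℕ (suc n)
  ... | yes j≡0 | _       = inj₁ j≡0
  ... | no _    | yes j≡⊤ = inj₂ j≡⊤
  ... | no j≢0  | no j≢⊤  = contradiction
    (subst (λ i → toℕ j ≤ toℕ i) (sym (inverseʳ π))
      (subst (toℕ j ≤_) (sym (toℕ-fromℕ n)) (s≤s⁻¹ (≢fromℕ⇒< j≢⊤))))
    -- The witnesses are the positions of the least and the greatest value of `π`, which any
    -- intermediate `j` separates.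
    (not-between π j good (π ⟨$⟩ˡ 0F) (π ⟨$⟩ˡ fromℕ n)
      (subst (λ i → toℕ i ℕ.< toℕ j) (sym (inverseʳ π)) (≢0F⇒0< j≢0)))

  open AvoidersOfTwo ρ213 ρ231 (λ _ → 0F) (λ _ → fromℕ _)
    (λ _ → z≤n) head<fromℕ insert⁺ insert⁻ public using (count≡C)

module Avoid132,213 where

  -- The new letter takes over the value of the old first letter, which `punchIn` raises by one: the
  -- new letter is followed by its successor.
  head : Permutation′ (suc n) → Fin (2+ n)
  head π = inject₁ (π ⟨$⟩ʳ 0F)

  head≡ : (π : Permutation′ (suc n)) → toℕ (head π) ≡ toℕ (π ⟨$⟩ʳ 0F)
  head≡ π = toℕ-inject₁ (π ⟨$⟩ʳ 0F)

  -- `i<punchIn⁻` yields only a weak inequality. Equality would, by injectivity, put `b` at the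
  -- first position, but `b` comes after `a`.
  head<later : (π : Permutation′ (suc n)) {a b : Fin (suc n)} → a < b →
               head π < punchIn (head π) (π ⟨$⟩ʳ b) → π ⟨$⟩ʳ 0F < π ⟨$⟩ʳ b
  head<later π {b = b} a<b lt = ℕ.≤∧≢⇒<
    (subst (_≤ toℕ (π ⟨$⟩ʳ b)) (head≡ π) (i<punchIn⁻ (head π) (π ⟨$⟩ʳ b) lt))
    (λ eq → ℕ.m<n⇒n≢0 a<b (sym (cong toℕ (⟨$⟩ʳ-injective π (toℕ-injective eq)))))

  -- An occurrence using the new letter is turned into one in π by using the
  -- first letter of π instead.

  insert⁺ : (π : Permutation′ (suc n)) (j : Fin (2+ n)) → AvoidsBoth ρ132 ρ213 π →
            j ≡ head π ⊎ j ≡ fromℕ (suc n) → AvoidsBoth ρ132 ρ213 (insert 0F j π)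
  insert⁺ {n} π j (g₁ , g₂) (inj₁ refl) =
    avoids-insert {ρ = ρ132} j π g₁ ¬132 , avoids-insert {ρ = ρ213} j π g₂ ¬213
    where
    ¬132 : ∀ a b → a < b → ¬ Matches ρ132 (insert 0F j π ⟨$⟩ʳ_) 0F (suc a) (suc b)
    ¬132 a b a<b (j<πb , πb<πa) =
      g₁ (matches⇒contains {π = π} {ρ132} (≢0F⇒0< a≢0) a<b (π0<πb , punchIn-cancel-< j πb<πa))
      where
      π0<πb = head<later π a<b j<πb
      a≢0 : a ≢ 0F
      a≢0 refl = ℕ.<-asym (punchIn-cancel-< j πb<πa) π0<πb

    ¬213 : ∀ a b → a < b → ¬ Matches ρ213 (insert 0F j π ⟨$⟩ʳ_) 0F (suc a) (suc b)
    ¬213 a b a<b (πa<j , j<πb) =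
      g₂ (matches⇒contains {π = π} {ρ213} (≢0F⇒0< a≢0) a<b (πa<π0 , π0<πb))
      where
      π0<πb = head<later π a<b j<πb
      πa<π0 = subst (toℕ (π ⟨$⟩ʳ a) ℕ.<_) (head≡ π) (punchIn<i⁻ j (π ⟨$⟩ʳ a) πa<j)
      a≢0 : a ≢ 0F
      a≢0 refl = ℕ.<-irrefl refl πa<π0
  -- Both 132 and 213 begin with a letter that is below a later one, which the greatest letter never
  -- is.
  insert⁺ π j (g₁ , g₂) (inj₂ refl) =
    avoids-insert {ρ = ρ132} j π g₁ (λ _ _ _ (lt , _) → ≮punchIn-fromℕ _ lt) ,
    avoids-insert {ρ = ρ213} j π g₂ (λ _ _ _ (_ , lt) → ≮punchIn-fromℕ _ lt)

  insert⁻ : (π : Permutation′ (suc n)) (j : Fin (2+ n)) → AvoidsBoth ρ132 ρ213 (insert 0F j π) →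
            j ≡ head π ⊎ j ≡ fromℕ (suc n)
  insert⁻ {n} π j (g₁ , g₂) with j ≟ fromℕ (suc n)
  ... | yes j≡⊤ = inj₂ j≡⊤
  ... | no  j≢⊤ with ℕ.<-cmp (toℕ j) (toℕ (π ⟨$⟩ʳ 0F))
  ...   | tri≈ _ j≡π0 _ = inj₁ (toℕ-injective (trans j≡π0 (sym (head≡ π))))
  -- Here `c` is the position in `π` of the value of `j`, which `punchIn` raises to its successor.
  -- The new letter, the old first letter and this successor form a 132.
  ...   | tri< j<π0 _ _ = ⊥-elim (g₁
    (matches⇒contains {π = insert 0F j π} {ρ132} z<s (s<s (≢0F⇒0< c≢0))
      (i<punchIn⁺ j _ (ℕ.≤-reflexive (sym πc≡j)) ,
       punchIn-mono-< j (subst (ℕ._< toℕ (π ⟨$⟩ʳ 0F)) (sym πc≡j) j<π0))))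
    where
    c = π ⟨$⟩ˡ fromℕ< (≢fromℕ⇒< j≢⊤)
    πc≡j : toℕ (π ⟨$⟩ʳ c) ≡ toℕ j
    πc≡j = trans (cong toℕ (inverseʳ π)) (toℕ-fromℕ< (≢fromℕ⇒< j≢⊤))
    c≢0 : c ≢ 0F
    c≢0 c≡0 = ℕ.<-irrefl (sym πc≡j) (subst (λ i → toℕ j ℕ.< toℕ (π ⟨$⟩ʳ i)) (sym c≡0) j<π0)
  -- Here `c` is the position of the greatest value of `π`, which ends up above `j`. The new letter,
  -- the old first letter and this one form a 213.
  ...   | tri> _ _ π0<j = ⊥-elim (g₂
    (matches⇒contains {π = insert 0F j π} {ρ213} z<s (s<s (≢0F⇒0< c≢0))
      (punchIn<i⁺ j _ π0<j , i<punchIn⁺ j _ j≤πc)))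
    where
    c = π ⟨$⟩ˡ fromℕ n
    j≤πc : toℕ j ≤ toℕ (π ⟨$⟩ʳ c)
    j≤πc = subst (λ i → toℕ j ≤ toℕ i) (sym (inverseʳ π))
      (subst (toℕ j ≤_) (sym (toℕ-fromℕ n)) (s≤s⁻¹ (≢fromℕ⇒< j≢⊤)))
    c≢0 : c ≢ 0F
    c≢0 c≡0 = ℕ.<⇒≱ π0<j (subst (λ i → toℕ j ≤ toℕ (π ⟨$⟩ʳ i)) c≡0 j≤πc)

  open AvoidersOfTwo ρ132 ρ213 head (λ _ → fromℕ _)
    (λ π → ℕ.≤-reflexive (head≡ π)) head<fromℕ insert⁺ insert⁻ public using (count≡C)

proposition12 : (n k : ℕ) → 1 ≤ n →
    aᵖᵏ n k ρ132 ρ213 ≡ aᵛˡ n k ρ132 ρ213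
    × aᵛˡ n k ρ132 ρ213 ≡ aᵖᵏ n k ρ213 ρ231
    × aᵖᵏ n k ρ213 ρ231 ≡ aᵛˡ n k ρ213 ρ231
    × aᵛˡ n k ρ213 ρ231 ≡ n C (2 * k + 1)
proposition12 n k 1≤n =
  trans pk₁ (sym vl₁) , trans vl₁ (sym pk₂) , trans pk₂ (sym vl₂) , vl₂
  where
  pk₁ = Avoid132,213.count≡C pk true pk≡turns n k 1≤n
  vl₁ = Avoid132,213.count≡C vl false vl≡turns n k 1≤n
  pk₂ = Avoid213,231.count≡C pk true pk≡turns n k 1≤n
  vl₂ = Avoid213,231.count≡C vl false vl≡turns n k 1≤n
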